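{- For $n\in\mathbb{N}$, $\mathcal{F}_n$ is equal to the number of lattice points in $H_{1,n}$ minus the number of lattice points in $H_{2,n}$, where for $H_{1,n}$ all points on the boundary are included except for those on the boundary curve $xy=n/2$, and for $H_{2,n}$ all points on the boundary are included. That is, $$\mathcal{F}_n=\#\{(x,y)\in\mathbb{Z}^2 : x,y\ge 1,\ n/2<xy\le n\}-\#\{(x,y)\in\mathbb{Z}^2 : x,y\ge 1,\ xy\le n/2\}.$$
   Context: $\mathbb{N}$ denotes the set of positive integers. For $n\in\mathbb{N}$, $\mathcal{F}_n = \#\{k\in\mathbb{Z} : 1\le k\le n,\ \lfloor n/k\rfloor\text{ is odd}\}$, where $\lfloor\cdot\rfloor$ is the floor function. $H_{1,n}$ is the hyperbolic region in the $xy$-plane with $x,y\ge 1$ bounded by the hyperbolas $xy=n$ and $xy=n/2$. $H_{2,n}$ is the region in the $xy$-plane bounded by the lines $x=1$, $y=1$ and the hyperbola $xy=n/2$ (i.e. the points with $x,y\ge1$ and $xy\le n/2$). Lattice points are points of $\mathbb{Z}^2$. -}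

module Defs where

open import Data.Integer using (ℤ; +_; 1ℤ; _+_; _*_; _≤_; _≤?_; +≤+; _/ℕ_; _%ℕ_)
open import Data.Integer.DivMod using (n%ℕd<d; a≡a%ℕn+[a/ℕn]*n)
open import Data.Integer.Divisibility.Signed using (_∣_; divides; ∣m+n∣m⇒∣n; ∣⇒∣ᵤ)
import Data.Integer.Properties as ℤ
open import Data.Nat as ℕ using (ℕ; zero; suc; s≤s)
import Data.Nat.Properties as ℕ
import Data.Nat.Divisibility as ℕ
open import Data.Rational.Unnormalised as ℚᵘ using (_/_; _÷_; floor; *≤*)
open import Data.List using (List; length; map; upTo; filter; cartesianProduct)
open import Data.List.Membership.Propositional using (_∈_)
open import Data.List.Membership.Propositional.Properties
  using (∈-filter⁺; ∈-filter⁻; ∈-map⁺; ∈-upTo⁺; ∈-cartesianProduct⁺)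
open import Data.List.Relation.Unary.Unique.Propositional using (Unique)
open import Data.List.Relation.Unary.Unique.Propositional.Properties
  using (map⁺; upTo⁺; filter⁺; cartesianProduct⁺)
open import Data.Product using (Σ; ∃; _×_; _,_; proj₁; proj₂)
open import Function using (_⇔_; mk⇔)
open import Relation.Binary.PropositionalEquality using (_≡_; trans; cong; subst)
open import Relation.Nullary using (yes; no; contradiction)
open import Relation.Nullary.Decidable using (_×-dec_)
open import Relation.Unary using (Pred; Decidable)
open import Level using (0ℓ)

record Finite {A : Set} (P : Pred A 0ℓ) : Set where
  field
    elements : List A
    unique   : Unique elements
    exact    : ∀ {a} → a ∈ elements ⇔ P a

-- All enumerations of P have the same length, so the choice of instance is immaterial.
# : {A : Set} (P : Pred A 0ℓ) → {{Finite P}} → ℕ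
# P {{fin}} = length (Finite.elements fin)

Odd : Pred ℤ 0ℓ
Odd z = ∃ λ q → z ≡ + 2 * q + 1ℤ

1≤⇒NonZero : ∀ {k} → 1ℤ ≤ k → ℚᵘ.NonZero (k / 1)
1≤⇒NonZero {+ suc _} _ = _
1≤⇒NonZero {+ zero} (+≤+ ())

floorDiv : (n : ℕ) (k : ℤ) → 1ℤ ≤ k → ℤ
floorDiv n k 1≤k = floor (_÷_ (+ n / 1) (k / 1) {{1≤⇒NonZero 1≤k}})

OddQuotient : ℕ → Pred ℤ 0ℓ
OddQuotient n k = Σ (1ℤ ≤ k) λ 1≤k → k ≤ + n × Odd (floorDiv n k 1≤k)

-- H₁ n and H₂ n are the sets of lattice points of the regions, not the plane regions themselves.
H₁ : ℕ → Pred (ℤ × ℤ) 0ℓ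
H₁ n (x , y) =
  1ℤ ≤ x × 1ℤ ≤ y × (+ n / 2) ℚᵘ.< (x * y) / 1 × x * y ≤ + n

H₂ : ℕ → Pred (ℤ × ℤ) 0ℓ
H₂ n (x , y) = 1ℤ ≤ x × 1ℤ ≤ y × (x * y) / 1 ℚᵘ.≤ (+ n / 2)

-- The following shows that the three sets above are finite, so that # applies to them.

filterFinite : {A : Set} {P : Pred A 0ℓ} → Decidable P →
  (xs : List A) → Unique xs → (∀ {a} → P a → a ∈ xs) → Finite P
filterFinite P? xs xs! P⊆xs = record
  { elements = filter P? xs
  ; unique   = filter⁺ P? xs!
  ; exact    = mk⇔ (λ a∈ → proj₂ (∈-filter⁻ P? {xs = xs} a∈))
                   (λ p → ∈-filter⁺ P? (P⊆xs p) p)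
  }

odd? : Decidable Odd
odd? z with z %ℕ 2 | n%ℕd<d z 2 | a≡a%ℕn+[a/ℕn]*n z 2
... | 0 | _ | eq = no λ { (q , z≡) →
  contradiction (ℕ.∣1⇒≡1 (∣⇒∣ᵤ (∣m+n∣m⇒∣n {m = + 2 * q}
    (subst (+ 2 ∣_) z≡ (divides (z /ℕ 2) (trans eq (ℤ.+-identityˡ _))))
    (divides q (ℤ.*-comm (+ 2) q))))) λ () }
... | 1 | _ | eq = yes (z /ℕ 2 ,
  trans eq (trans (ℤ.+-comm 1ℤ (z /ℕ 2 * + 2)) (cong (_+ 1ℤ) (ℤ.*-comm (z /ℕ 2) (+ 2)))))
... | suc (suc _) | s≤s (s≤s ()) | _

oddQuotient? : ∀ n → Decidable (OddQuotient n)
oddQuotient? n k with 1ℤ ≤? k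
... | no ¬1≤k = no λ p → ¬1≤k (proj₁ p)
... | yes 1≤k with (k ≤? + n) ×-dec odd? (floorDiv n k 1≤k)
...   | yes p = yes (1≤k , p)
...   | no ¬p = no λ { (_ , k≤n , odd) → ¬p (k≤n , odd) }

H₁? : ∀ n → Decidable (H₁ n)
H₁? n (x , y) = (1ℤ ≤? x) ×-dec (1ℤ ≤? y) ×-dec
  ((+ n / 2) ℚᵘ.<? (x * y) / 1) ×-dec (x * y ≤? + n)

H₂? : ∀ n → Decidable (H₂ n)
H₂? n (x , y) = (1ℤ ≤? x) ×-dec (1ℤ ≤? y) ×-dec ((x * y) / 1 ℚᵘ.≤? (+ n / 2))

interval : ℕ → List ℤ
interval n = map +_ (upTo (suc n))

interval! : ∀ n → Unique (interval n)
interval! n = map⁺ ℤ.+-injective (upTo⁺ (suc n))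

∈-interval : ∀ {n k} → 1ℤ ≤ k → k ≤ + n → k ∈ interval n
∈-interval {k = + _} _ (+≤+ k≤n) = ∈-map⁺ +_ (∈-upTo⁺ (s≤s k≤n))

square : ℕ → List (ℤ × ℤ)
square n = cartesianProduct (interval n) (interval n)

∈-square : ∀ {n x y} → 1ℤ ≤ x → 1ℤ ≤ y → x * y ≤ + n → (x , y) ∈ square n
∈-square {n} {+ suc a} {+ suc b} 1≤x 1≤y xy≤n = ∈-cartesianProduct⁺
  (∈-interval 1≤x (ℤ.≤-trans (+≤+ (ℕ.m≤m*n (suc a) (suc b))) xy≤n))
  (∈-interval 1≤y (ℤ.≤-trans (+≤+ (ℕ.m≤n*m (suc b) (suc a))) xy≤n))
∈-square {x = + zero} (+≤+ ()) _ _
∈-square {x = + suc _} {+ zero} _ (+≤+ ()) _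

half-bound : ∀ {n x y} → 1ℤ ≤ x → 1ℤ ≤ y → (x * y) / 1 ℚᵘ.≤ (+ n / 2) → x * y ≤ + n
half-bound {n} {+ suc a} {+ suc b} _ _ (*≤* 2xy≤n) =
  ℤ.≤-trans (+≤+ (ℕ.m≤m*n (suc a ℕ.* suc b) 2))
    (subst (+ (suc a ℕ.* suc b ℕ.* 2) ≤_) (ℤ.*-identityʳ (+ n)) 2xy≤n)
half-bound {x = + zero} (+≤+ ()) _ _
half-bound {x = + suc _} {+ zero} _ (+≤+ ()) _

square! : ∀ n → Unique (square n)
square! n = cartesianProduct⁺ (interval! n) (interval! n)

instance
  finite-OddQuotient : ∀ {n} → Finite (OddQuotient n)
  finite-OddQuotient {n} = filterFinite (oddQuotient? n) (interval n) (interval! n)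
    λ { (1≤k , k≤n , _) → ∈-interval 1≤k k≤n }

  finite-H₁ : ∀ {n} → Finite (H₁ n)
  finite-H₁ {n} = filterFinite (H₁? n) (square n) (square! n)
    λ { (1≤x , 1≤y , _ , xy≤n) → ∈-square 1≤x 1≤y xy≤n }

  finite-H₂ : ∀ {n} → Finite (H₂ n)
  finite-H₂ {n} = filterFinite (H₂? n) (square n) (square! n)
    λ { {x , y} (1≤x , 1≤y , xy≤n/2) →
      ∈-square 1≤x 1≤y (half-bound {n} {x} {y} 1≤x 1≤y xy≤n/2) }

𝓕 : ℕ → ℕ
𝓕 n = # (OddQuotient n)

{-# OPTIONS --safe #-}

-- Count column by column. For x ≥ 1 put q = ⌊n/x⌋. The points of H₂ in the column over x have
-- 1 ≤ y ≤ ⌊q/2⌋ and those of H₁ have ⌊q/2⌋ < y ≤ q, so the difference of the two counts is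
-- q − 2⌊q/2⌋, which is 1 if q is odd and 0 otherwise.
module Submission where

open import Defs
open import Data.Nat using (ℕ; NonZero)
open import Data.Integer using (+_; _-_)
open import Relation.Binary.PropositionalEquality using (_≡_)

open import Data.Nat as ℕ using (zero; suc; z≤n; s≤s)
import Data.Nat.Properties as ℕ
import Data.Nat.Divisibility as ℕ
open import Data.Nat.DivMod
  using (_/_; _%_; m*n/n≡m; m/n*n≤m; /-monoˡ-≤; m≡m%n+[m/n]*n; m%n<n; m/n≤m)
open import Data.Nat.Tactic.RingSolver using (solve-∀)
open import Data.Integer as ℤ using (ℤ; -[1+_]; 1ℤ; +≤+)
import Data.Integer.Properties as ℤ
open import Data.Integer.DivMod using (div-pos-is-/ℕ)
open import Data.Integer.Divisibility.Signed using (divides; ∣m+n∣m⇒∣n; ∣⇒∣ᵤ)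
open import Data.Rational.Unnormalised as ℚᵘ using (*≤*)
import Data.Rational.Unnormalised.Properties as ℚᵘ
open import Data.List using (List; []; _∷_; _++_; [_]; length; map; filter; applyUpTo; cartesianProduct)
open import Data.List.Properties using (length-++; length-applyUpTo; filter-++; filter-none; filter-accept; filter-reject)
open import Data.List.Membership.Propositional using (_∈_)
open import Data.List.Membership.Propositional.Properties
  using (∈-filter⁺; ∈-filter⁻; ∈-map⁻; ∈-map⁺; ∈-upTo⁺; ∈-applyUpTo⁺; ∈-applyUpTo⁻)
open import Data.List.Membership.Propositional.Properties.WithK using (unique∧set⇒bag)
open import Data.List.Relation.Binary.BagAndSetEquality using (∼bag⇒↭)
open import Data.List.Relation.Binary.Permutation.Propositional.Properties using (↭-length)
open import Data.List.Relation.Unary.All using (universal)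
open import Data.List.Relation.Unary.Unique.Propositional.Properties using (filter⁺; applyUpTo⁺₁)
open import Data.Product using (_×_; _,_; proj₁)
open import Function using (_∘_; _⇔_; mk⇔; Equivalence)
open import Level using (0ℓ)
open import Relation.Binary.PropositionalEquality
  using (refl; sym; trans; cong; cong₂; subst; module ≡-Reasoning)
open import Relation.Nullary using (¬_; yes; no; contradiction)
open import Relation.Unary using (Pred; Decidable)

open Equivalence using (to; from)

count : {A : Set} {P : Pred A 0ℓ} → Decidable P → List A → ℕ
count P? xs = length (filter P? xs)

module _ {A : Set} {P : Pred A 0ℓ} (P? : Decidable P) where

  count-++ : ∀ xs ys → count P? (xs ++ ys) ≡ count P? xs ℕ.+ count P? ys
  count-++ xs ys = trans (cong length (filter-++ P? xs ys)) (length-++ (filter P? xs))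

  count-none : (∀ x → ¬ P x) → ∀ xs → count P? xs ≡ 0
  count-none ¬P xs = cong length (filter-none P? (universal ¬P xs))

  count-map : {B : Set} (f : B → A) (xs : List B) → count P? (map f xs) ≡ count (P? ∘ f) xs
  count-map f []       = refl
  count-map f (x ∷ xs) with P? (f x)
  ... | yes _ = cong suc (count-map f xs)
  ... | no  _ = count-map f xs

module _ {A B : Set} {P : Pred A 0ℓ} {Q R : Pred (A × B) 0ℓ}
         (P? : Decidable P) (Q? : Decidable Q) (R? : Decidable R) (ys : List B)
         (column : ∀ x → count P? [ x ] ℕ.+ count (λ y → Q? (x , y)) ys ≡ count (λ y → R? (x , y)) ys)
         where

  -- Induction on `xs`: the product list for `x ∷ xs` is the column over `x` followed by the product
  -- list for `xs`. Since `count P? [ x ]` is the indicator of `P x`, the hypothesis `column` is the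
  -- same identity for one column. Both are stated additively to avoid truncated subtraction.
  count-columns : ∀ xs →
    count P? xs ℕ.+ count Q? (cartesianProduct xs ys) ≡ count R? (cartesianProduct xs ys)
  count-columns []       = refl
  count-columns (x ∷ xs) = begin
    count P? (x ∷ xs) ℕ.+ count Q? (cartesianProduct (x ∷ xs) ys)
      ≡⟨ cong₂ ℕ._+_ (count-++ P? [ x ] xs) (split Q?) ⟩
    (count P? [ x ] ℕ.+ count P? xs) ℕ.+ (count (λ y → Q? (x , y)) ys ℕ.+ count Q? (cartesianProduct xs ys))
      ≡⟨ interchange (count P? [ x ]) _ _ _ ⟩
    (count P? [ x ] ℕ.+ count (λ y → Q? (x , y)) ys) ℕ.+ (count P? xs ℕ.+ count Q? (cartesianProduct xs ys))
      ≡⟨ cong₂ ℕ._+_ (column x) (count-columns xs) ⟩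
    count (λ y → R? (x , y)) ys ℕ.+ count R? (cartesianProduct xs ys)
      ≡⟨ split R? ⟨
    count R? (cartesianProduct (x ∷ xs) ys) ∎
    where
    open ≡-Reasoning

    interchange : ∀ a b c d → (a ℕ.+ b) ℕ.+ (c ℕ.+ d) ≡ (a ℕ.+ c) ℕ.+ (b ℕ.+ d)
    interchange = solve-∀

    split : {S : Pred (A × B) 0ℓ} (S? : Decidable S) →
      count S? (cartesianProduct (x ∷ xs) ys) ≡
        count (λ y → S? (x , y)) ys ℕ.+ count S? (cartesianProduct xs ys)
    split S? = trans (count-++ S? (map (x ,_) ys) _) (cong (ℕ._+ _) (count-map S? (x ,_) ys))

-- The filtered list and the list of `l + 1`, ..., `u` are both free of repetitions and have the
-- same members, so they are permutations of each other. The bound `u ≤ n` keeps the second list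
-- inside `interval n`.
count-interval : {P : Pred ℤ 0ℓ} (P? : Decidable P) (n l u : ℕ) → u ℕ.≤ n →
  (∀ y → P (+ y) ⇔ (l ℕ.< y × y ℕ.≤ u)) → count P? (interval n) ≡ u ℕ.∸ l
count-interval {P} P? n l u u≤n P⇔ = trans
  (↭-length (∼bag⇒↭ (unique∧set⇒bag
    (filter⁺ P? (interval! n))
    (applyUpTo⁺₁ f (u ℕ.∸ l) λ i<j _ eq →
      ℕ.<⇒≢ i<j (ℕ.+-cancelˡ-≡ (suc l) _ _ (ℤ.+-injective eq)))
    (mk⇔ ⇒ ⇐))))
  (length-applyUpTo f (u ℕ.∸ l))
  where
  f : ℕ → ℤ
  f i = + (suc l ℕ.+ i)

  ⇒ : ∀ {z} → z ∈ filter P? (interval n) → z ∈ applyUpTo f (u ℕ.∸ l)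
  ⇒ z∈ with ∈-filter⁻ P? {xs = interval n} z∈
  ... | z∈interval , Pz with ∈-map⁻ +_ z∈interval
  ... | y , _ , refl with to (P⇔ y) Pz
  -- The position of `y` in the target list is `y ∸ suc l`, which is less than `y ∸ l`, hence than
  -- `u ∸ l`.
  ... | l<y , y≤u = subst (_∈ applyUpTo f (u ℕ.∸ l)) (cong +_ (ℕ.m+[n∸m]≡n l<y))
    (∈-applyUpTo⁺ f (ℕ.<-≤-trans (ℕ.∸-monoʳ-< ℕ.≤-refl l<y) (ℕ.∸-monoˡ-≤ l y≤u)))

  ⇐ : ∀ {z} → z ∈ applyUpTo f (u ℕ.∸ l) → z ∈ filter P? (interval n)
  ⇐ z∈ with ∈-applyUpTo⁻ f z∈
  ... | i , i<u∸l , refl = ∈-filter⁺ P?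
    (∈-map⁺ +_ (∈-upTo⁺ (s≤s (ℕ.≤-trans y≤u u≤n))))
    (from (P⇔ (suc l ℕ.+ i)) (s≤s (ℕ.m≤m+n l i) , y≤u))
    where
    y≤u : suc l ℕ.+ i ℕ.≤ u
    y≤u = subst (ℕ._≤ u) (trans (ℕ.+-comm (suc i) l) (ℕ.+-suc l i))
      -- Undoing the truncated subtraction requires `l ≤ u`; this holds because `i < u ∸ l` makes
      -- `u ∸ l` nonzero.
      (ℕ.m≤o∸n⇒m+n≤o (suc i) (ℕ.<⇒≤ (ℕ.m∸n≢0⇒n<m (ℕ.m<n⇒n≢0 i<u∸l))) i<u∸l)

-- Galois connection between multiplication by `d` and floor division by `d`. It turns every bound
-- on `x * y` into a bound on `y` alone.
*≤⇔≤/ : ∀ m n d .{{_ : NonZero d}} → m ℕ.* d ℕ.≤ n ⇔ m ℕ.≤ n / d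
*≤⇔≤/ m n d = mk⇔
  (λ md≤n → subst (ℕ._≤ n / d) (m*n/n≡m m d) (/-monoˡ-≤ d md≤n))
  (λ m≤n/d → ℕ.≤-trans (ℕ.*-monoˡ-≤ d m≤n/d) (m/n*n≤m n d))

-- The unnormalised quotient has numerator `n * 1` and denominator `1 * suc a`, which computes to
-- `suc (a + 0)`; only these trivial terms have to be removed.
floorDiv≡/ : ∀ n a (p : 1ℤ ℤ.≤ + suc a) → floorDiv n (+ suc a) p ≡ + (n / suc a)
floorDiv≡/ n a p = trans (div-pos-is-/ℕ (+ n ℤ.* 1ℤ) (suc (a ℕ.+ 0))) eq
  where
  eq : (+ n ℤ.* 1ℤ) ℤ./ℕ suc (a ℕ.+ 0) ≡ + (n / suc a)
  eq rewrite ℤ.*-identityʳ (+ n) | ℕ.+-identityʳ a = refl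

Odd⇔%2≡1 : ∀ q → Odd (+ q) ⇔ q % 2 ≡ 1
Odd⇔%2≡1 q = mk⇔ ⇒ ⇐
  where
  ⇐ : q % 2 ≡ 1 → Odd (+ q)
  ⇐ r≡1 = + (q / 2) , (begin
    + q                          ≡⟨ cong +_ (m≡m%n+[m/n]*n q 2) ⟩
    + (q % 2 ℕ.+ q / 2 ℕ.* 2)    ≡⟨ cong +_ (cong₂ ℕ._+_ r≡1 (ℕ.*-comm (q / 2) 2)) ⟩
    + (1 ℕ.+ 2 ℕ.* (q / 2))      ≡⟨ cong +_ (ℕ.+-comm 1 (2 ℕ.* (q / 2))) ⟩
    + (2 ℕ.* (q / 2)) ℤ.+ 1ℤ     ≡⟨ cong (ℤ._+ 1ℤ) (ℤ.pos-* 2 (q / 2)) ⟩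
    + 2 ℤ.* + (q / 2) ℤ.+ 1ℤ     ∎)
    where open ≡-Reasoning

  ⇒ : Odd (+ q) → q % 2 ≡ 1
  ⇒ (w , q≡) with q % 2 | m%n<n q 2 | m≡m%n+[m/n]*n q 2
  ... | 1 | _ | _ = refl
  ... | suc (suc _) | s≤s (s≤s ()) | _
  -- With remainder 0, the number 2 divides both `2w + 1` and `2w`, hence 1.
  ... | 0 | _ | q≡2h = contradiction (ℕ.∣1⇒≡1 (∣⇒∣ᵤ (∣m+n∣m⇒∣n {m = + 2 ℤ.* w}
    (divides (+ (q / 2)) (trans (sym q≡) (trans (cong +_ q≡2h) (ℤ.pos-* (q / 2) 2))))
    (divides w (ℤ.*-comm (+ 2) w))))) λ ()

-- Cross-multiplication gives `x * y * 2 ≤ n * 1`. Reordered as `y * 2 * x ≤ n`, it passes through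
-- `*≤⇔≤/` twice, first dividing by `x` and then by 2.
half⇔ : ∀ n a b →
  (+ suc a ℤ.* + suc b) ℚᵘ./ 1 ℚᵘ.≤ + n ℚᵘ./ 2 ⇔ suc b ℕ.≤ n / suc a / 2
half⇔ n a b = mk⇔
  (λ { (*≤* le) → to (*≤⇔≤/ (suc b) _ 2) (to (*≤⇔≤/ (suc b ℕ.* 2) n (suc a))
    (subst (ℕ._≤ n) (rotate (suc a) (suc b))
      (ℤ.drop‿+≤+ (subst (_ ℤ.≤_) (ℤ.*-identityʳ (+ n)) le)))) })
  (λ le → *≤* (subst (_ ℤ.≤_) (sym (ℤ.*-identityʳ (+ n)))
    (+≤+ (subst (ℕ._≤ n) (sym (rotate (suc a) (suc b)))
      (from (*≤⇔≤/ (suc b ℕ.* 2) n (suc a)) (from (*≤⇔≤/ (suc b) _ 2) le))))))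
  where
  rotate : ∀ x y → x ℕ.* y ℕ.* 2 ≡ y ℕ.* 2 ℕ.* x
  rotate = solve-∀

module _ (n a : ℕ) where
  private
    q = n / suc a
    h = q / 2

  1≤+suc : ∀ {b} → 1ℤ ℤ.≤ + suc b
  1≤+suc = +≤+ (s≤s z≤n)

  -- The strict bound `n/2 < xy` is the negation of the inequality in `half⇔`, which gives `h < y`;
  -- the bound `xy ≤ n` gives `y ≤ q`.
  H₁-column : ∀ y → H₁ n (+ suc a , + y) ⇔ (h ℕ.< y × y ℕ.≤ q)
  H₁-column zero    = mk⇔ (λ { (_ , +≤+ () , _) }) (λ { (() , _) })
  H₁-column (suc b) = mk⇔
    (λ { (_ , _ , >half , +≤+ xy≤n) →
      ℕ.≰⇒> (ℚᵘ.<⇒≱ >half ∘ from (half⇔ n a b)) ,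
      to (*≤⇔≤/ (suc b) n (suc a)) (subst (ℕ._≤ n) (ℕ.*-comm (suc a) (suc b)) xy≤n) })
    (λ { (h<y , y≤q) →
      1≤+suc , 1≤+suc , ℚᵘ.≰⇒> (ℕ.<⇒≱ h<y ∘ to (half⇔ n a b)) ,
      +≤+ (subst (ℕ._≤ n) (ℕ.*-comm (suc b) (suc a)) (from (*≤⇔≤/ (suc b) n (suc a)) y≤q)) })

  H₂-column : ∀ y → H₂ n (+ suc a , + y) ⇔ (0 ℕ.< y × y ℕ.≤ h)
  H₂-column zero    = mk⇔ (λ { (_ , +≤+ () , _) }) (λ { (() , _) })
  H₂-column (suc b) = mk⇔
    (λ { (_ , _ , ≤half) → s≤s z≤n , to (half⇔ n a b) ≤half })
    (λ { (_ , y≤h) → 1≤+suc , 1≤+suc , from (half⇔ n a b) y≤h })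

  -- From right to left, the bound `suc a ≤ n` comes from parity: an odd `q` is at least 1, and
  -- `1 ≤ n / suc a` means `suc a ≤ n`.
  OddQuotient⇔ : OddQuotient n (+ suc a) ⇔ q % 2 ≡ 1
  OddQuotient⇔ = mk⇔
    (λ { (p , _ , odd) → to (Odd⇔%2≡1 q) (subst Odd (floorDiv≡/ n a p) odd) })
    (λ r≡1 → 1≤+suc , +≤+ (x≤n r≡1) ,
      subst Odd (sym (floorDiv≡/ n a 1≤+suc)) (from (Odd⇔%2≡1 q) r≡1))
    where
    1≤q : q % 2 ≡ 1 → 1 ℕ.≤ q
    1≤q r≡1 = subst (1 ℕ.≤_) (sym (m≡m%n+[m/n]*n q 2))
      (ℕ.≤-trans (ℕ.≤-reflexive (sym r≡1)) (ℕ.m≤m+n (q % 2) _))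

    x≤n : q % 2 ≡ 1 → suc a ℕ.≤ n
    x≤n r≡1 = subst (ℕ._≤ n) (ℕ.*-identityˡ (suc a)) (from (*≤⇔≤/ 1 n (suc a)) (1≤q r≡1))

  count-OddQuotient : count (oddQuotient? n) [ + suc a ] ≡ q % 2
  count-OddQuotient with q % 2 | m%n<n q 2 | OddQuotient⇔
  ... | 0 | _ | odd⇔ = cong length (filter-reject (oddQuotient? n) λ p → contradiction (to odd⇔ p) λ ())
  ... | 1 | _ | odd⇔ = cong length (filter-accept (oddQuotient? n) (from odd⇔ refl))
  ... | suc (suc _) | s≤s (s≤s ()) | _

  positive-column :
    count (oddQuotient? n) [ + suc a ] ℕ.+ count (λ y → H₂? n (+ suc a , y)) (interval n) ≡
      count (λ y → H₁? n (+ suc a , y)) (interval n)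
  positive-column = begin
    count (oddQuotient? n) [ + suc a ] ℕ.+ count (λ y → H₂? n (+ suc a , y)) (interval n)
      ≡⟨ cong₂ ℕ._+_ count-OddQuotient
           (count-interval (λ y → H₂? n (+ suc a , y)) n 0 h (ℕ.≤-trans (m/n≤m q 2) q≤n) H₂-column) ⟩
    q % 2 ℕ.+ h
      -- Adding and subtracting `h` exposes `q % 2 + h * 2`, which is `q`.
      ≡⟨ ℕ.m+n∸n≡m (q % 2 ℕ.+ h) h ⟨
    q % 2 ℕ.+ h ℕ.+ h ℕ.∸ h
      ≡⟨ cong (ℕ._∸ h) (double (q % 2) h) ⟩
    q % 2 ℕ.+ h ℕ.* 2 ℕ.∸ h
      ≡⟨ cong (ℕ._∸ h) (m≡m%n+[m/n]*n q 2) ⟨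
    q ℕ.∸ h
      ≡⟨ count-interval (λ y → H₁? n (+ suc a , y)) n h q q≤n H₁-column ⟨
    count (λ y → H₁? n (+ suc a , y)) (interval n) ∎
    where
    open ≡-Reasoning

    q≤n : q ℕ.≤ n
    q≤n = m/n≤m n (suc a)

    double : ∀ r s → r ℕ.+ s ℕ.+ s ≡ r ℕ.+ s ℕ.* 2
    double = solve-∀

-- All three predicates contain `1 ≤ x`, so every count vanishes. The case does occur, since
-- `interval n` starts at 0.
nonpositive-column : ∀ n x → ¬ 1ℤ ℤ.≤ x →
  count (oddQuotient? n) [ x ] ℕ.+ count (λ y → H₂? n (x , y)) (interval n) ≡
    count (λ y → H₁? n (x , y)) (interval n)
nonpositive-column n x 1≰x = trans
  (cong₂ ℕ._+_
    (cong length (filter-reject (oddQuotient? n) (1≰x ∘ proj₁)))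
    (count-none (λ y → H₂? n (x , y)) (λ _ → 1≰x ∘ proj₁) (interval n)))
  (sym (count-none (λ y → H₁? n (x , y)) (λ _ → 1≰x ∘ proj₁) (interval n)))

column : ∀ n x →
  count (oddQuotient? n) [ x ] ℕ.+ count (λ y → H₂? n (x , y)) (interval n) ≡
    count (λ y → H₁? n (x , y)) (interval n)
column n (+ suc a)    = positive-column n a
column n (+ zero)     = nonpositive-column n (+ zero) λ { (+≤+ ()) }
column n x@(-[1+ _ ]) = nonpositive-column n x λ ()

proposition2p3 : ∀ (n : ℕ) .{{_ : NonZero n}} → + (𝓕 n) ≡ + (# (H₁ n)) - + (# (H₂ n))
proposition2p3 n = begin
  + (𝓕 n)
    ≡⟨ cong +_ (ℕ.m+n∸n≡m (𝓕 n) (# (H₂ n))) ⟨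
  + (𝓕 n ℕ.+ # (H₂ n) ℕ.∸ # (H₂ n))
    -- Truncated and integer subtraction agree here, as the subtrahend is one of the two summands.
    ≡⟨ ℤ.⊖-≥ (ℕ.m≤n+m (# (H₂ n)) (𝓕 n)) ⟨
  (𝓕 n ℕ.+ # (H₂ n)) ℤ.⊖ # (H₂ n)
    ≡⟨ ℤ.m-n≡m⊖n (𝓕 n ℕ.+ # (H₂ n)) (# (H₂ n)) ⟨
  + (𝓕 n ℕ.+ # (H₂ n)) - + (# (H₂ n))
    -- The three cardinalities unfold to counts over `interval n` and over its square, so
    -- `count-columns` applies with both lists equal to `interval n`.
    ≡⟨ cong (λ m → + m - + (# (H₂ n)))
         (count-columns (oddQuotient? n) (H₂? n) (H₁? n) (interval n) (column n) (interval n)) ⟩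
  + (# (H₁ n)) - + (# (H₂ n)) ∎
  where open ≡-Reasoning
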